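{- Let $P$ be a finite poset with zeta matrix $Z_P$, let $M_P = Z_P^{ -1}$, and set $\mathfrak{Z}_P = Z_P + Z_P^t$ and $\mathfrak{M}_P = M_P + M_P^t$. Then $\det(\mathfrak{M}_P) = \det(\mathfrak{Z}_P)$.
   Context: For a finite poset $P$ with $n$ elements labelled $x_1,\ldots,x_n$ so that $x_i < x_j$ implies $i<j$, the zeta matrix $Z_P$ is the $n\times n$ matrix with $(Z_P)_{ij}=1$ if $x_i\le x_j$ and $(Z_P)_{ij}=0$ otherwise. With this labelling $Z_P$ is unipotent upper triangular, hence invertible; $M_P=Z_P^{ -1}$ is called the Möbius matrix of $P$. The superscript $t$ denotes transpose. -}

module Defs where

open import Algebra.Properties.Semiring.Sum as Sum using ()
open import Data.Bool.Base using (if_then_else_)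
open import Data.Fin.Base using (Fin; zero; suc; toℕ; _<_; punchIn)
open import Data.Fin.Properties using (_≟_; <⇒≢; <-asym)
open import Data.Integer.Base using (ℤ; 0ℤ; 1ℤ; -1ℤ; _+_; _*_; -_; _^_)
open import Data.Integer.Properties
  using (+-*-semiring; *-assoc; *-identityˡ; *-identityʳ; *-zeroˡ; *-zeroʳ;
         +-identityˡ; +-identityʳ; +-inverseˡ; +-inverseʳ; -1*i≡-i;
         neg-distribˡ-*)
open import Data.Nat.Base using (ℕ; zero; suc; z<s; s<s)
open import Data.Product.Base using (Σ-syntax; _×_; _,_; proj₁; proj₂)
open import Data.Vec.Functional using (Vector; transpose)
open import Function.Base using (_∘_)
open import Function.Bundles using (Bijection)
open import Level using (Level; _⊔_)
open import Relation.Binary.Bundles using (DecPoset)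
open import Relation.Binary.PropositionalEquality
  using (_≡_; sym; trans; cong; cong₂; setoid; module ≡-Reasoning)
open import Relation.Nullary using (does; yes; no; contradiction)
import Relation.Binary.Properties.Poset as PosetProperties

open Sum +-*-semiring public using (sum)
open Sum +-*-semiring
  using (sum-syntax; sum-cong-≗; sum-replicate-zero; ∑-comm;
         *-distribˡ-sum; *-distribʳ-sum)

private
  variable
    c ℓ₁ ℓ₂ : Level
    m n p : ℕ

Matrix : ℕ → ℕ → Set
Matrix m n = Vector (Vector ℤ n) m

infix  4 _≋_
infixl 6 _⊕_
infixl 7 _⊗_
infix  8 _ᵗ

_≋_ : Matrix m n → Matrix m n → Set
A ≋ B = ∀ i j → A i j ≡ B i j

_⊕_ : Matrix m n → Matrix m n → Matrix m n
(A ⊕ B) i j = A i j + B i j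

_⊗_ : Matrix m n → Matrix n p → Matrix m p
(A ⊗ B) i j = sum (λ k → A i k * B k j)

_ᵗ : Matrix m n → Matrix n m
_ᵗ = transpose

identity : Matrix n n
identity i j = if does (i ≟ j) then 1ℤ else 0ℤ

minor : Matrix (suc m) (suc n) → Fin (suc m) → Fin (suc n) → Matrix m n
minor A i j k l = A (punchIn i k) (punchIn j l)

-- Laplace expansion along the first row.
det : Matrix n n → ℤ
det {zero}  A = 1ℤ
det {suc n} A = sum (λ j → -1ℤ ^ toℕ j * A zero j * det (minor A zero j))

Invertible : Matrix n n → Set
Invertible {n} A = Σ[ B ∈ Matrix n n ] (A ⊗ B ≋ identity × B ⊗ A ≋ identity)

inverse : {A : Matrix n n} → Invertible A → Matrix n n
inverse = proj₁

record UnipotentUpperTriangular (A : Matrix n n) : Set where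
  field
    diagonal : ∀ i → A i i ≡ 1ℤ
    below    : ∀ i j → j < i → A i j ≡ 0ℤ

private
  sum-zero : (f : Vector ℤ n) → (∀ k → f k ≡ 0ℤ) → sum f ≡ 0ℤ
  sum-zero {n} f f≡0 = trans (sum-cong-≗ f≡0) (sum-replicate-zero n)

  sum-identity : (f : Vector ℤ n) (j : Fin n) →
                 sum (λ k → f k * identity k j) ≡ f j
  sum-identity f zero = begin
    f zero * 1ℤ + sum (λ k → f (suc k) * 0ℤ)
      ≡⟨ cong₂ _+_ (*-identityʳ (f zero)) (sum-zero _ λ k → *-zeroʳ (f (suc k))) ⟩
    f zero + 0ℤ
      ≡⟨ +-identityʳ (f zero) ⟩
    f zero ∎
    where open ≡-Reasoning
  sum-identity f (suc j) = begin
    f zero * 0ℤ + sum (λ k → f (suc k) * identity k j)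
      ≡⟨ cong₂ _+_ (*-zeroʳ (f zero)) (sum-identity (f ∘ suc) j) ⟩
    0ℤ + f (suc j)
      ≡⟨ +-identityˡ (f (suc j)) ⟩
    f (suc j) ∎
    where open ≡-Reasoning

  sum-neg : (f : Vector ℤ n) → sum (λ k → - f k) ≡ - sum f
  sum-neg f = begin
    sum (λ k → - f k)     ≡⟨ sum-cong-≗ (λ k → sym (-1*i≡-i (f k))) ⟩
    sum (λ k → -1ℤ * f k) ≡⟨ *-distribˡ-sum -1ℤ f ⟨
    -1ℤ * sum f           ≡⟨ -1*i≡-i (sum f) ⟩
    - sum f               ∎
    where open ≡-Reasoning

  vec-assoc : (r : Vector ℤ m) (B : Matrix m n) (C : Vector ℤ n) →
              sum (λ k → sum (λ l → r l * B l k) * C k) ≡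
              sum (λ l → r l * sum (λ k → B l k * C k))
  vec-assoc r B C = begin
    sum (λ k → sum (λ l → r l * B l k) * C k)
      ≡⟨ sum-cong-≗ (λ k → *-distribʳ-sum (C k) (λ l → r l * B l k)) ⟩
    sum (λ k → sum (λ l → r l * B l k * C k))
      ≡⟨ ∑-comm (λ k l → r l * B l k * C k) ⟩
    sum (λ l → sum (λ k → r l * B l k * C k))
      ≡⟨ sum-cong-≗ (λ l → sum-cong-≗ (λ k → *-assoc (r l) (B l k) (C k))) ⟩
    sum (λ l → sum (λ k → r l * (B l k * C k)))
      ≡⟨ sum-cong-≗ (λ l → sym (*-distribˡ-sum (r l) (λ k → B l k * C k))) ⟩
    sum (λ l → r l * sum (λ k → B l k * C k)) ∎
    where open ≡-Reasoning

-- Writing A in block form with first row (1 , r), first column zero below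
-- the diagonal and lower right block A′, the inverse has first row
-- (1 , - r A′⁻¹) and lower right block A′⁻¹.
unipotent-invertible : (A : Matrix n n) → UnipotentUpperTriangular A → Invertible A
unipotent-invertible {zero}  A U = A , (λ ()) , (λ ())
unipotent-invertible {suc n} A U = M , right , left
  where
  open UnipotentUpperTriangular U
  open ≡-Reasoning

  A′ : Matrix n n
  A′ i j = A (suc i) (suc j)

  r : Vector ℤ n
  r j = A zero (suc j)

  IH : Invertible A′
  IH = unipotent-invertible A′ record
    { diagonal = diagonal ∘ suc
    ; below    = λ i j j<i → below (suc i) (suc j) (s<s j<i)
    }

  B : Matrix n n
  B = inverse IH

  rB : Vector ℤ n
  rB j = sum (λ l → r l * B l j)

  M : Matrix (suc n) (suc n)
  M zero    zero    = 1ℤ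
  M zero    (suc j) = - rB j
  M (suc i) zero    = 0ℤ
  M (suc i) (suc j) = B i j

  column : ∀ i → A (suc i) zero ≡ 0ℤ
  column i = below (suc i) zero z<s

  right : A ⊗ M ≋ identity
  right zero zero = cong₂ _+_
    (trans (*-identityʳ _) (diagonal zero))
    (sum-zero _ λ k → *-zeroʳ (r k))
  right zero (suc j) = begin
    A zero zero * - rB j + rB j ≡⟨ cong (λ a → a * - rB j + rB j) (diagonal zero) ⟩
    1ℤ * - rB j + rB j          ≡⟨ cong (_+ rB j) (*-identityˡ (- rB j)) ⟩
    - rB j + rB j               ≡⟨ +-inverseˡ (rB j) ⟩
    0ℤ                          ∎
  right (suc i) zero = cong₂ _+_
    (trans (*-identityʳ _) (column i))
    (sum-zero _ λ k → *-zeroʳ (A′ i k))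
  right (suc i) (suc j) = begin
    A (suc i) zero * - rB j + (A′ ⊗ B) i j
      ≡⟨ cong₂ (λ a b → a * - rB j + b) (column i) (proj₁ (proj₂ IH) i j) ⟩
    0ℤ * - rB j + identity i j
      ≡⟨ cong (_+ identity i j) (*-zeroˡ (- rB j)) ⟩
    0ℤ + identity i j
      ≡⟨ +-identityˡ (identity i j) ⟩
    identity i j ∎

  left : M ⊗ A ≋ identity
  left zero zero = cong₂ _+_
    (trans (*-identityˡ _) (diagonal zero))
    (sum-zero _ λ k → trans (cong (- rB k *_) (column k)) (*-zeroʳ (- rB k)))
  left zero (suc j) = begin
    1ℤ * r j + sum (λ k → - rB k * A′ k j)
      ≡⟨ cong₂ _+_ (*-identityˡ (r j))
           (sum-cong-≗ (λ k → sym (neg-distribˡ-* (rB k) (A′ k j)))) ⟩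
    r j + sum (λ k → - (rB k * A′ k j))
      ≡⟨ cong (r j +_) (sum-neg (λ k → rB k * A′ k j)) ⟩
    r j + - sum (λ k → rB k * A′ k j)
      ≡⟨ cong (λ s → r j + - s) (vec-assoc r B (λ k → A′ k j)) ⟩
    r j + - sum (λ l → r l * (B ⊗ A′) l j)
      ≡⟨ cong (λ s → r j + - s)
           (sum-cong-≗ (λ l → cong (r l *_) (proj₂ (proj₂ IH) l j))) ⟩
    r j + - sum (λ l → r l * identity l j)
      ≡⟨ cong (λ s → r j + - s) (sum-identity r j) ⟩
    r j + - r j
      ≡⟨ +-inverseʳ (r j) ⟩
    0ℤ ∎
  left (suc i) zero = cong₂ _+_
    (*-zeroˡ (A zero zero))
    (sum-zero _ λ k → trans (cong (B i k *_) (column k)) (*-zeroʳ (B i k)))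
  left (suc i) (suc j) = begin
    0ℤ * r j + (B ⊗ A′) i j ≡⟨ cong₂ _+_ (*-zeroˡ (r j)) (proj₂ (proj₂ IH) i j) ⟩
    0ℤ + identity i j       ≡⟨ +-identityˡ (identity i j) ⟩
    identity i j            ∎

-- A listing x₁, …, xₙ of all the elements of P, without repetition (both up
-- to the equality _≈_ of P), in which xᵢ < xⱼ implies i < j.  Having one says
-- that P is finite with n elements.
record Labelling (P : DecPoset c ℓ₁ ℓ₂) (n : ℕ) : Set (c ⊔ ℓ₁ ⊔ ℓ₂) where
  private
    module P = DecPoset P
  open PosetProperties P.poset using () renaming (_<_ to _<ᴾ_)
  field
    bijection : Bijection (setoid (Fin n)) P.Eq.setoid

  x : Fin n → P.Carrier
  x = Bijection.to bijection

  field
    increasing : ∀ i j → x i <ᴾ x j → i < j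

module _ (P : DecPoset c ℓ₁ ℓ₂) (L : Labelling P n) where
  open DecPoset P using (_≤?_; refl)
  open Labelling L

  zeta : Matrix n n
  zeta i j = if does (x i ≤? x j) then 1ℤ else 0ℤ

  zeta-unipotent : UnipotentUpperTriangular zeta
  zeta-unipotent = record { diagonal = diagonal ; below = below }
    where
    diagonal : ∀ i → zeta i i ≡ 1ℤ
    diagonal i with x i ≤? x i
    ... | yes _   = _≡_.refl
    ... | no  x≰x = contradiction refl x≰x

    below : ∀ i j → j < i → zeta i j ≡ 0ℤ
    below i j j<i with x i ≤? x j
    ... | no  _ = _≡_.refl
    ... | yes xi≤xj = contradiction (increasing i j (xi≤xj , xi≉xj)) (<-asym j<i)
      where
      xi≉xj = λ xi≈xj →
        <⇒≢ j<i (sym (Bijection.injective bijection xi≈xj))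

  zeta-invertible : Invertible zeta
  zeta-invertible = unipotent-invertible zeta zeta-unipotent

  möbius : Matrix n n
  möbius = inverse zeta-invertible

  symZeta : Matrix n n
  symZeta = zeta ⊕ zeta ᵗ

  symMöbius : Matrix n n
  symMöbius = möbius ⊕ möbius ᵗ

{-# OPTIONS --safe #-}

-- With Z the zeta matrix and M its inverse, Z (M + Mᵗ) Zᵗ = Zᵗ + Z.  It
-- remains to see that multiplying by the unipotent triangular Z on the left, or
-- by Zᵗ on the right, preserves the determinant; the second case is the
-- transpose of the first.  On the left, the first row of Z A is the first row
-- of A plus a combination of the other rows, which does not affect the
-- determinant; the other rows of Z A only involve the lower right block of Z,
-- which is again unipotent.
module Submission where

open import Defs
open import Algebra.Properties.Semiring.Sum as Sum using ()
open import Data.Fin.Base using (Fin; zero; suc; toℕ; punchIn)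
open import Data.Integer.Base using (ℤ; +0; 0ℤ; 1ℤ; -1ℤ; _+_; _*_; -_; _^_)
open import Data.Integer.Properties
  using (+-*-semiring; +-identityʳ; +-identityˡ; *-identityˡ; *-zeroʳ; *-zeroˡ;
         *-assoc; *-comm; *-distribˡ-+; neg-involutive)
open import Data.Integer.Tactic.RingSolver using (solve-∀)
open import Data.Nat.Base using (ℕ; zero; suc; z<s; s<s)
open import Data.Product.Base using (proj₁; proj₂)
open import Data.Vec.Functional using (Vector; _∷_; tail)
open import Function.Base using (_∘_)
open import Level using (Level)
open import Relation.Binary.Bundles using (DecPoset)
open import Relation.Binary.PropositionalEquality
  using (_≡_; refl; sym; trans; cong; cong₂; module ≡-Reasoning)

open Sum +-*-semiring
  using (sum-cong-≗; sum-replicate-zero; ∑-comm; ∑-distrib-+;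
         *-distribˡ-sum; *-distribʳ-sum)
open ≡-Reasoning

private
  variable
    m n p q : ℕ

-- Sums and matrix products over the integers.

sum-zero : (f : Vector ℤ n) → (∀ k → f k ≡ 0ℤ) → sum f ≡ 0ℤ
sum-zero {n} f f≡0 = trans (sum-cong-≗ f≡0) (sum-replicate-zero n)

⊗-cong : {A A′ : Matrix m n} {B B′ : Matrix n p} → A ≋ A′ → B ≋ B′ → A ⊗ B ≋ A′ ⊗ B′
⊗-cong A≋A′ B≋B′ i j = sum-cong-≗ λ k → cong₂ _*_ (A≋A′ i k) (B≋B′ k j)

⊗-identityˡ : (A : Matrix m n) → identity ⊗ A ≋ A
⊗-identityˡ A zero j = begin
  1ℤ * A zero j + sum (λ k → 0ℤ * A (suc k) j)
    ≡⟨ cong₂ _+_ (*-identityˡ (A zero j)) (sum-zero _ λ k → *-zeroˡ (A (suc k) j)) ⟩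
  A zero j + 0ℤ
    ≡⟨ +-identityʳ _ ⟩
  A zero j ∎
⊗-identityˡ A (suc i) j = begin
  0ℤ * A zero j + sum (λ k → identity i k * A (suc k) j)
    ≡⟨ cong₂ _+_ (*-zeroˡ (A zero j)) (⊗-identityˡ (tail A) i j) ⟩
  0ℤ + A (suc i) j
    ≡⟨ +-identityˡ _ ⟩
  A (suc i) j ∎

⊗-assoc : (A : Matrix m n) (B : Matrix n p) (C : Matrix p q) →
          (A ⊗ B) ⊗ C ≋ A ⊗ (B ⊗ C)
⊗-assoc A B C i j = begin
  sum (λ k → sum (λ l → A i l * B l k) * C k j)
    ≡⟨ sum-cong-≗ (λ k → *-distribʳ-sum (C k j) (λ l → A i l * B l k)) ⟩
  sum (λ k → sum (λ l → A i l * B l k * C k j))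
    ≡⟨ ∑-comm (λ k l → A i l * B l k * C k j) ⟩
  sum (λ l → sum (λ k → A i l * B l k * C k j))
    ≡⟨ sum-cong-≗ (λ l → sum-cong-≗ (λ k → *-assoc (A i l) (B l k) (C k j))) ⟩
  sum (λ l → sum (λ k → A i l * (B l k * C k j)))
    ≡⟨ sum-cong-≗ (λ l → sym (*-distribˡ-sum (A i l) (λ k → B l k * C k j))) ⟩
  sum (λ l → A i l * sum (λ k → B l k * C k j)) ∎

⊗-distribˡ-⊕ : (A : Matrix m n) (B C : Matrix n p) → A ⊗ (B ⊕ C) ≋ A ⊗ B ⊕ A ⊗ C
⊗-distribˡ-⊕ A B C i j = trans
  (sum-cong-≗ λ k → *-distribˡ-+ (A i k) (B k j) (C k j))
  (∑-distrib-+ (λ k → A i k * B k j) (λ k → A i k * C k j))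

⊗-ᵗ : (A : Matrix m n) (B : Matrix n p) → (A ⊗ B) ᵗ ≋ B ᵗ ⊗ A ᵗ
⊗-ᵗ A B i j = sum-cong-≗ λ k → *-comm (A j k) (B k i)

-- Any nonzero integer and its negation have different constructors, so `+0` is the only possible
-- case. This turns invariance of a determinant under a row swap into its vanishing.
i≡-i⇒i≡0 : ∀ {i} → i ≡ - i → i ≡ 0ℤ
i≡-i⇒i≡0 {+0} _ = refl

-- Laplace expansion and transposition.

sign : Fin n → ℤ
sign j = -1ℤ ^ toℕ j

det-cong : {A B : Matrix n n} → A ≋ B → det A ≡ det B
det-cong {zero}  A≋B = refl
det-cong {suc n} A≋B = sum-cong-≗ λ j →
  cong₂ (λ a d → sign j * a * d) (A≋B zero j)
    (det-cong λ k l → A≋B (suc k) (punchIn j l))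

-- Expanding the remaining minors once more, by the first column on one side
-- and by the first row on the other, gives the same double sum.
det-firstColumn : (A : Matrix (suc n) (suc n)) →
                  det A ≡ sum (λ i → sign i * A i zero * det (minor A i zero))
det-firstColumn {zero}  A = refl
-- The corner term is common to both expansions; only the remaining terms are compared.
det-firstColumn {suc n} A = cong (1ℤ * A zero zero * det A′ +_) (begin
  sum (λ j → sign (suc j) * r j * det (minor A zero (suc j)))
    ≡⟨ sum-cong-≗ (λ j → cong (sign (suc j) * r j *_)
         (det-firstColumn (minor A zero (suc j)))) ⟩
  sum (λ j → sign (suc j) * r j * sum (λ i → sign i * c i * d i j))
    ≡⟨ sum-cong-≗ (λ j → *-distribˡ-sum (sign (suc j) * r j)
         (λ i → sign i * c i * d i j)) ⟩
  sum (λ j → sum (λ i → sign (suc j) * r j * (sign i * c i * d i j)))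
    ≡⟨ ∑-comm (λ j i → sign (suc j) * r j * (sign i * c i * d i j)) ⟩
  sum (λ i → sum (λ j → sign (suc j) * r j * (sign i * c i * d i j)))
    ≡⟨ sum-cong-≗ (λ i → sum-cong-≗ (λ j →
         exchange (sign j) (r j) (sign i) (c i) (d i j))) ⟩
  sum (λ i → sum (λ j → sign (suc i) * c i * (sign j * r j * d i j)))
    ≡⟨ sum-cong-≗ (λ i → sym (*-distribˡ-sum (sign (suc i) * c i)
         (λ j → sign j * r j * d i j))) ⟩
  sum (λ i → sign (suc i) * c i * det (minor A (suc i) zero)) ∎)
  where
  A′ : Matrix (suc n) (suc n)
  A′ = minor A zero zero

  r c : Vector ℤ (suc n)
  r j = A zero (suc j)
  c i = A (suc i) zero

  -- Both orders of deleting two rows and two columns compute to the same submatrix, so `d` serves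
  -- both double sums.
  d : Matrix (suc n) (suc n)
  d i j = det (minor A′ i j)

  exchange : ∀ s a t b e → -1ℤ * s * a * (t * b * e) ≡ -1ℤ * t * b * (s * a * e)
  exchange = solve-∀

-- By induction on the minors, the first-row expansion of `A ᵗ` becomes the first-column expansion
-- of `A`.
det-ᵗ : (A : Matrix n n) → det (A ᵗ) ≡ det A
det-ᵗ {zero}  A = refl
det-ᵗ {suc n} A = begin
  sum (λ j → sign j * A j zero * det (minor A j zero ᵗ))
    ≡⟨ sum-cong-≗ (λ j → cong (sign j * A j zero *_) (det-ᵗ (minor A j zero))) ⟩
  sum (λ j → sign j * A j zero * det (minor A j zero))
    ≡⟨ det-firstColumn A ⟨
  det A ∎

-- Row exchanges and repeated rows.

swapFirstRows : Matrix (suc (suc m)) n → Matrix (suc (suc m)) n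
swapFirstRows A = A (suc zero) ∷ A zero ∷ tail (tail A)

-- By expansion along the first column: the first two terms are exchanged with
-- opposite signs, and in every other term the minor has its first two rows
-- swapped.
det-swapFirstRows : (A : Matrix (suc (suc n)) (suc (suc n))) →
                    det (swapFirstRows A) ≡ - det A
det-swapFirstRows {n} A = begin
  det S
    ≡⟨ det-firstColumn S ⟩
  1ℤ * c₁ * det (minor S zero zero) +
  (-1ℤ * c₀ * det (minor S (suc zero) zero) +
   sum (λ i → sign (suc (suc i)) * c i * det (minor S (suc (suc i)) zero)))
    ≡⟨ cong₂ (λ x y → 1ℤ * c₁ * x + y) (det-cong first)
         (cong₂ (λ x y → -1ℤ * c₀ * x + y) (det-cong second)
           (sum-cong-≗ λ i → cong (sign (suc (suc i)) * c i *_) (later A i))) ⟩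
  1ℤ * c₁ * d₁ +
  (-1ℤ * c₀ * d₀ + sum (λ i → sign (suc (suc i)) * c i * (- d i)))
    ≡⟨ cong (λ z → 1ℤ * c₁ * d₁ + (-1ℤ * c₀ * d₀ + z))
         (trans (sum-cong-≗ λ i → move-neg (sign (suc (suc i)) * c i) (d i))
           (sym (*-distribˡ-sum -1ℤ (λ i → sign (suc (suc i)) * c i * d i)))) ⟩
  1ℤ * c₁ * d₁ + (-1ℤ * c₀ * d₀ + -1ℤ * rest)
    ≡⟨ regroup c₀ c₁ d₀ d₁ rest ⟩
  - (1ℤ * c₀ * d₀ + (-1ℤ * c₁ * d₁ + rest))
    ≡⟨ cong -_ (det-firstColumn A) ⟨
  - det A ∎
  where
  S : Matrix (suc (suc n)) (suc (suc n))
  S = swapFirstRows A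

  c : Vector ℤ n
  c i = A (suc (suc i)) zero

  d : Vector ℤ n
  d i = det (minor A (suc (suc i)) zero)

  c₀ c₁ d₀ d₁ rest : ℤ
  c₀ = A zero zero
  c₁ = A (suc zero) zero
  d₀ = det (minor A zero zero)
  d₁ = det (minor A (suc zero) zero)
  rest = sum (λ i → sign (suc (suc i)) * c i * d i)

  first : minor S zero zero ≋ minor A (suc zero) zero
  first zero    l = refl
  first (suc k) l = refl

  second : minor S (suc zero) zero ≋ minor A zero zero
  second zero    l = refl
  second (suc k) l = refl

  -- Quantified over its own size, so that matching on `suc n` leaves a minor with at least two
  -- rows, where the induction hypothesis applies; at size `zero` there is no `i`.
  later : ∀ {n} (A : Matrix (suc (suc n)) (suc (suc n))) (i : Fin n) →
          det (minor (swapFirstRows A) (suc (suc i)) zero) ≡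
          - det (minor A (suc (suc i)) zero)
  later {suc n} A i = trans (det-cong swapped)
    (det-swapFirstRows (minor A (suc (suc i)) zero))
    where
    swapped : minor (swapFirstRows A) (suc (suc i)) zero ≋
              swapFirstRows (minor A (suc (suc i)) zero)
    swapped zero          l = refl
    swapped (suc zero)    l = refl
    swapped (suc (suc k)) l = refl

  move-neg : ∀ a b → a * (- b) ≡ -1ℤ * (a * b)
  move-neg = solve-∀

  regroup : ∀ a b x y z → 1ℤ * b * y + (-1ℤ * a * x + -1ℤ * z) ≡
                          - (1ℤ * a * x + (-1ℤ * b * y + z))
  regroup = solve-∀

-- If the repeated row is not the second one, swapping the first two rows
-- brings the repetition into the minors of the first-row expansion.
det-repeatedRow : (A : Matrix (suc n) (suc n)) (k : Fin n) →
                  (∀ j → A zero j ≡ A (suc k) j) → det A ≡ 0ℤ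
det-repeatedRow A zero A₀≡A₁ = i≡-i⇒i≡0 (begin
  det A                   ≡⟨ det-cong symmetric ⟩
  det (swapFirstRows A)   ≡⟨ det-swapFirstRows A ⟩
  - det A                 ∎)
  where
  symmetric : A ≋ swapFirstRows A
  symmetric zero          j = A₀≡A₁ j
  symmetric (suc zero)    j = sym (A₀≡A₁ j)
  symmetric (suc (suc i)) j = refl
det-repeatedRow A (suc k) A₀≡Aₖ = begin
  det A                     ≡⟨ neg-involutive (det A) ⟨
  - (- det A)               ≡⟨ cong -_ (det-swapFirstRows A) ⟨
  - det (swapFirstRows A)   ≡⟨ cong -_ (sum-zero _ vanishes) ⟩
  0ℤ                        ∎
  where
  vanishes : ∀ j → sign j * A (suc zero) j * det (minor (swapFirstRows A) zero j) ≡ 0ℤ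
  vanishes j = trans
    (cong (sign j * A (suc zero) j *_)
      (det-repeatedRow (minor (swapFirstRows A) zero j) k λ l → A₀≡Aₖ (punchIn j l)))
    (*-zeroʳ (sign j * A (suc zero) j))

-- Unipotent factors and the symmetrised inverse.

det-unipotent-⊗ : (U A : Matrix n n) → UnipotentUpperTriangular U → det (U ⊗ A) ≡ det A
det-unipotent-⊗ {zero}  U A u = refl
det-unipotent-⊗ {suc n} U A u = begin
  sum (λ j → sign j * sum (λ k → U zero k * A k j) * det (minor (U ⊗ A) zero j))
    ≡⟨ sum-cong-≗ (λ j → cong (sign j * sum (λ k → U zero k * A k j) *_)
         (trans (det-cong (block j)) (det-unipotent-⊗ U′ (minor A zero j) u′))) ⟩
  sum (λ j → sign j * sum (λ k → U zero k * A k j) * d j)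
    ≡⟨ sum-cong-≗ expand ⟩
  sum (λ j → sum (λ k → U zero k * (sign j * A k j * d j)))
    ≡⟨ ∑-comm (λ j k → U zero k * (sign j * A k j * d j)) ⟩
  sum (λ k → sum (λ j → U zero k * (sign j * A k j * d j)))
    -- Linearity in the first row: the inner sum is, by computation, the first-row expansion of `A`
    -- with its first row replaced by row `k`. For `k` equal to `zero` this is `det A`; otherwise a
    -- row occurs twice.
    ≡⟨ sum-cong-≗ (λ k → sym (*-distribˡ-sum (U zero k) (λ j → sign j * A k j * d j))) ⟩
  sum (λ k → U zero k * det (A k ∷ tail A))
    ≡⟨ cong₂ _+_
         (trans (cong (_* det A) (diagonal zero)) (*-identityˡ (det A)))
         (sum-zero _ λ k → trans
           (cong (U zero (suc k) *_) (det-repeatedRow (A (suc k) ∷ tail A) k λ j → refl))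
           (*-zeroʳ (U zero (suc k)))) ⟩
  det A + 0ℤ
    ≡⟨ +-identityʳ (det A) ⟩
  det A ∎
  where
  open UnipotentUpperTriangular u

  U′ : Matrix n n
  U′ = minor U zero zero

  u′ : UnipotentUpperTriangular U′
  u′ = record
    { diagonal = diagonal ∘ suc
    ; below    = λ i j j<i → below (suc i) (suc j) (s<s j<i)
    }

  d : Vector ℤ (suc n)
  d j = det (minor A zero j)

  block : ∀ j → minor (U ⊗ A) zero j ≋ U′ ⊗ minor A zero j
  block j k l = trans
    (cong (λ a → a * A zero (punchIn j l) + (U′ ⊗ minor A zero j) k l)
      (below (suc k) zero z<s))
    -- The product with `0ℤ` has already computed to `0ℤ`.
    (+-identityˡ _)

  rearrange : ∀ s a b e → s * (a * b) * e ≡ a * (s * b * e)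
  rearrange = solve-∀

  expand : ∀ j → sign j * sum (λ k → U zero k * A k j) * d j ≡
                 sum (λ k → U zero k * (sign j * A k j * d j))
  expand j = begin
    sign j * sum (λ k → U zero k * A k j) * d j
      ≡⟨ cong (_* d j) (*-distribˡ-sum (sign j) (λ k → U zero k * A k j)) ⟩
    sum (λ k → sign j * (U zero k * A k j)) * d j
      ≡⟨ *-distribʳ-sum (d j) (λ k → sign j * (U zero k * A k j)) ⟩
    sum (λ k → sign j * (U zero k * A k j) * d j)
      ≡⟨ sum-cong-≗ (λ k → rearrange (sign j) (U zero k) (A k j) (d j)) ⟩
    sum (λ k → U zero k * (sign j * A k j * d j)) ∎

-- Right multiplication by `U ᵗ` is replaced by transposing `X` and multiplying by `U` on the left.
-- Since `U ⊗ B` is the identity, `X ᵗ` is the identity plus `B ⊗ U ᵗ`, and a second factor `U`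
-- turns this into `U ⊕ U ᵗ`.
det-symmetrised-inverse : (U B : Matrix n n) → UnipotentUpperTriangular U →
                          U ⊗ B ≋ identity → det (B ⊕ B ᵗ) ≡ det (U ⊕ U ᵗ)
det-symmetrised-inverse U B u UB≋1 = begin
  det (B ⊕ B ᵗ)       ≡⟨ det-unipotent-⊗ U (B ⊕ B ᵗ) u ⟨
  det X               ≡⟨ det-ᵗ X ⟨
  det (X ᵗ)           ≡⟨ det-unipotent-⊗ U (X ᵗ) u ⟨
  det (U ⊗ X ᵗ)       ≡⟨ det-cong UXᵗ ⟩
  det (U ⊕ U ᵗ)       ∎
  where
  X : Matrix _ _
  X = U ⊗ (B ⊕ B ᵗ)

  Xᵗ : X ᵗ ≋ identity ᵗ ⊕ B ⊗ U ᵗ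
  Xᵗ i j = trans (⊗-distribˡ-⊕ U B (B ᵗ) j i)
    (cong₂ _+_ (UB≋1 j i) (⊗-ᵗ U (B ᵗ) i j))

  -- identity ᵗ i j only equals identity i j propositionally, so the product
  -- with it is computed on the other side.
  U1ᵗ : U ⊗ identity ᵗ ≋ U
  U1ᵗ i j = trans (sym (⊗-ᵗ identity (U ᵗ) i j)) (⊗-identityˡ (U ᵗ) j i)

  UXᵗ : U ⊗ X ᵗ ≋ U ⊕ U ᵗ
  UXᵗ i j = begin
    (U ⊗ X ᵗ) i j
      ≡⟨ ⊗-cong {A = U} (λ _ _ → refl) Xᵗ i j ⟩
    (U ⊗ (identity ᵗ ⊕ B ⊗ U ᵗ)) i j
      ≡⟨ ⊗-distribˡ-⊕ U (identity ᵗ) (B ⊗ U ᵗ) i j ⟩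
    (U ⊗ identity ᵗ) i j + (U ⊗ (B ⊗ U ᵗ)) i j
      ≡⟨ cong₂ _+_ (U1ᵗ i j) (sym (⊗-assoc U B (U ᵗ) i j)) ⟩
    U i j + ((U ⊗ B) ⊗ U ᵗ) i j
      ≡⟨ cong (U i j +_) (⊗-cong {B = U ᵗ} UB≋1 (λ _ _ → refl) i j) ⟩
    U i j + (identity ⊗ U ᵗ) i j
      ≡⟨ cong (U i j +_) (⊗-identityˡ (U ᵗ) i j) ⟩
    U i j + U j i ∎

theorem1 : {c ℓ₁ ℓ₂ : Level} (P : DecPoset c ℓ₁ ℓ₂) (n : ℕ) (L : Labelling P n) →
    det (symMöbius P L) ≡ det (symZeta P L)
theorem1 P n L =
  det-symmetrised-inverse (zeta P L) (möbius P L) (zeta-unipotent P L)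
    (proj₁ (proj₂ (zeta-invertible P L)))
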